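{- Let $\alpha=\omega^{\delta_n}s_n+\dots+\omega^{\delta_1}s_1+m$ be an infinite ordinal written in Cantor normal form, where $n,s_1,\dots,s_n\in\mathbb N=\{1,2,\dots\}$, $0<\delta_1<\dots<\delta_n$ and $m\in\omega$. Then $\mathbb P(\alpha)\cong\prod_{i=1}^n(\mathbb P(\omega^{\delta_i}))^{s_i}$, $\mathrm{sm}\,\mathbb P(\alpha)\cong\prod_{i=1}^n(\mathrm{sm}\,\mathbb P(\omega^{\delta_i}))^{s_i}$ and $\mathrm{sq}\,\mathbb P(\alpha)\cong\prod_{i=1}^n(\mathrm{sq}\,\mathbb P(\omega^{\delta_i}))^{s_i}$.
   Context: For an ordinal $X$, $\mathbb P(X)=\{f[X]: f:X\to X \text{ strictly increasing}\}$, ordered by $\subset$ (the poset of copies of $X$). Products of (pre)orders are ordered coordinatewise. For a preorder $\mathbb P=\langle P,\le\rangle$: $p\perp q$ means no $r$ satisfies $r\le p,q$; the separative modification is $\mathrm{sm}(\mathbb P)=\langle P,\le^*\rangle$ with $p\le^* q$ iff $\forall r\le p\,\exists s\le r\ (s\le q)$; the separative quotient $\mathrm{sq}(\mathbb P)$ is the antisymmetric quotient of $\mathrm{sm}(\mathbb P)$ (identify $p,q$ when $p\le^*q\le^*p$). -}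

module Defs where

open import Data.Empty using (⊥-elim)
open import Data.Fin.Base using (Fin; zero; suc)
import Data.Fin.Base as Fin
import Data.Fin.Induction as Fin
import Data.Fin.Properties as Fin
open import Data.List.Base using (List; []; _∷_; _++_)
import Data.List.Membership.Setoid as Membership
open import Data.List.Membership.Setoid.Properties using (∈-++⁺ˡ; ∈-++⁺ʳ)
open import Data.List.Relation.Unary.Any using (here; there)
open import Data.Nat.Base as ℕ using (ℕ; zero; suc)
import Data.Nat.Induction as ℕ
import Data.Nat.Properties as ℕ
open import Data.Product.Base using (Σ; ∃; ∃-syntax; _×_; _,_; proj₁; proj₂)
open import Data.Product.Relation.Binary.Lex.Strict using (×-strictTotalOrder; ×-wellFounded')
open import Data.Sum.Base using (_⊎_; inj₁; inj₂)
open import Data.Sum.Relation.Binary.LeftOrder using (⊎-<-isStrictTotalOrder; ⊎-<-wellFounded)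
open import Function.Base using (_∘_; id)
open import Function.Bundles using (_⇔_)
open import Induction.WellFounded using (WellFounded; Acc; acc)
open import Level using (Level; _⊔_; Lift; lift; lower) renaming (suc to lsuc)
open import Relation.Binary.Bundles using (Preorder; Poset; StrictTotalOrder)
open import Relation.Binary.Definitions using (Reflexive; Transitive; Irreflexive; Trichotomous; Tri; tri<; tri≈; tri>)
import Relation.Binary.Construct.Interior.Symmetric as SymmetricInterior
import Relation.Binary.Construct.On as On
open import Relation.Binary.Morphism.Structures using (IsOrderHomomorphism; IsOrderIsomorphism)
open import Relation.Binary.PropositionalEquality.Core using (_≡_; _≢_; refl; sym; trans; subst; subst₂)
open import Relation.Nullary.Decidable.Core using (Dec; yes; no)
open import Relation.Nullary.Negation.Core using (¬_)
open import Relation.Unary using (Pred; _⊆_; _≐_)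

private
  variable
    ℓ c ℓ₁ ℓ₂ c′ ℓ₁′ ℓ₂′ : Level

-- Ordinals are well-founded strict total orders, decidably so because a
-- StrictTotalOrder is trichotomous.  Equality of ordinals is order
-- isomorphism _≃ₒ_; the elements of an ordinal are compared by the
-- equality _≈_ of the underlying order.
record Ordinal ℓ : Set (lsuc ℓ) where
  field
    strictTotalOrder : StrictTotalOrder ℓ ℓ ℓ

  open StrictTotalOrder strictTotalOrder public

  field
    wellFounded : WellFounded _<_

infix 4 _≃ₒ_ _<ₒ_
infixl 6 _+ₒ_
infixl 7 _·ₒ_
infixl 8 _↓_

_≃ₒ_ : Ordinal ℓ → Ordinal ℓ → Set ℓ
X ≃ₒ Y = ∃[ f ] IsOrderIsomorphism X._≈_ Y._≈_ X._<_ Y._<_ f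
  where
  module X = Ordinal X
  module Y = Ordinal Y

_↓_ : (X : Ordinal ℓ) → Ordinal.Carrier X → Ordinal ℓ
X ↓ a = record
  { strictTotalOrder = On.strictTotalOrder X.strictTotalOrder (proj₁ {B = λ x → x X.< a})
  ; wellFounded      = On.wellFounded proj₁ X.wellFounded
  }
  where module X = Ordinal X

_<ₒ_ : Ordinal ℓ → Ordinal ℓ → Set ℓ
X <ₒ Y = ∃[ a ] X ≃ₒ Y ↓ a

fin : ℕ → Ordinal ℓ
fin {ℓ} m = record
  { strictTotalOrder = record
    { Carrier = Lift ℓ (Fin m)
    ; _≈_     = λ i j → Lift ℓ (lower i ≡ lower j)
    ; _<_     = _≺_
    ; isStrictTotalOrder = record
      { isStrictPartialOrder = record
        { isEquivalence = record
          { refl  = lift refl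
          ; sym   = λ (lift p) → lift (sym p)
          ; trans = λ (lift p) (lift q) → lift (trans p q)
          }
        ; irrefl   = λ (lift p) (lift q) → Fin.<-irrefl p q
        ; trans    = λ (lift p) (lift q) → lift (Fin.<-trans p q)
        ; <-resp-≈ = (λ { {x} (lift p) (lift q) → lift (subst (lower x Fin.<_) p q) })
                   , (λ { {x} (lift p) (lift q) → lift (subst (Fin._< lower x) p q) })
        }
      ; compare = compare
      }
    }
  ; wellFounded = λ i → accessible (Fin.<-wellFounded (lower i))
  }
  where
  _≺_ : Lift ℓ (Fin m) → Lift ℓ (Fin m) → Set ℓ
  i ≺ j = Lift ℓ (lower i Fin.< lower j)

  compare : Trichotomous (λ i j → Lift ℓ (lower i ≡ lower j)) _≺_
  compare i j with Fin.<-cmp (lower i) (lower j)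
  ... | tri< a b c = tri< (lift a) (b ∘ lower) (c ∘ lower)
  ... | tri≈ a b c = tri≈ (a ∘ lower) (lift b) (c ∘ lower)
  ... | tri> a b c = tri> (a ∘ lower) (b ∘ lower) (lift c)

  accessible : ∀ {i} → Acc Fin._<_ (lower i) → Acc _≺_ i
  accessible (acc rs) = acc λ (lift p) → accessible (rs p)

_+ₒ_ : Ordinal ℓ → Ordinal ℓ → Ordinal ℓ
X +ₒ Y = record
  { strictTotalOrder = record
    { isStrictTotalOrder = ⊎-<-isStrictTotalOrder X.isStrictTotalOrder Y.isStrictTotalOrder }
  ; wellFounded      = ⊎-<-wellFounded X.wellFounded Y.wellFounded
  }
  where
  module X = Ordinal X
  module Y = Ordinal Y

-- X ·ₒ Y consists of Y many copies of X, so the Y-coordinate is compared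
-- first.
_·ₒ_ : Ordinal ℓ → Ordinal ℓ → Ordinal ℓ
X ·ₒ Y = record
  { strictTotalOrder = ×-strictTotalOrder Y.strictTotalOrder X.strictTotalOrder
  ; wellFounded      = ×-wellFounded' Y.Eq.trans Y.<-respʳ-≈ Y.wellFounded X.wellFounded
  }
  where
  module X = Ordinal X
  module Y = Ordinal Y

-- ω^ δ is the set of finitely supported functions δ → ω, ordered by their
-- values at the largest argument where they differ.
module Power (δ : Ordinal ℓ) where

  private module δ = Ordinal δ
  open Membership δ.Eq.setoid using (_∈_)

  record FinSupp : Set ℓ where
    field
      value    : δ.Carrier → ℕ
      value-≈  : ∀ {x y} → x δ.≈ y → value x ≡ value y
      support  : List δ.Carrier
      support∋ : ∀ {x} → value x ≢ 0 → x ∈ support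

  open FinSupp

  infix 4 _≈_ _<_

  _≈_ : FinSupp → FinSupp → Set ℓ
  f ≈ g = ∀ x → value f x ≡ value g x

  _<_ : FinSupp → FinSupp → Set ℓ
  f < g = ∃[ x ] value f x ℕ.< value g x × (∀ {y} → x δ.< y → value f y ≡ value g y)

  private

    largest : (P : δ.Carrier → Set) → (∀ x → Dec (P x)) → (∀ {x y} → x δ.≈ y → P x → P y) →
              ∀ L → (∀ {y} → y ∈ L → ¬ P y)
                  ⊎ (∃[ x ] P x × (∀ {y} → y ∈ L → P y → ¬ x δ.< y))
    largest P P? resp [] = inj₁ λ ()
    largest P P? resp (z ∷ L) with P? z | largest P P? resp L
    ... | no ¬pz | inj₁ none = inj₁ λ
      { (here y≈z) py → ¬pz (resp y≈z py)
      ; (there y∈L)   → none y∈L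
      }
    ... | no ¬pz | inj₂ (x , px , max) = inj₂ (x , px , λ
      { (here y≈z) py → ⊥-elim (¬pz (resp y≈z py))
      ; (there y∈L)   → max y∈L
      })
    ... | yes pz | inj₁ none = inj₂ (z , pz , λ
      { (here y≈z) _   → δ.irrefl (δ.Eq.sym y≈z)
      ; (there y∈L) py → ⊥-elim (none y∈L py)
      })
    ... | yes pz | inj₂ (x , px , max) with δ.compare x z
    ...   | tri< x<z _ _ = inj₂ (z , pz , λ
      { (here y≈z) _   → δ.irrefl (δ.Eq.sym y≈z)
      ; (there y∈L) py → λ z<y → max y∈L py (δ.trans x<z z<y)
      })
    ...   | tri≈ x≮z _ _ = inj₂ (x , px , λ
      { (here y≈z) _ → λ x<y → x≮z (δ.<-respʳ-≈ y≈z x<y)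
      ; (there y∈L)  → max y∈L
      })
    ...   | tri> x≮z _ _ = inj₂ (x , px , λ
      { (here y≈z) _ → λ x<y → x≮z (δ.<-respʳ-≈ y≈z x<y)
      ; (there y∈L)  → max y∈L
      })

    <-irrefl : Irreflexive _≈_ _<_
    <-irrefl f≈g (x , lt , _) = ℕ.<-irrefl (f≈g x) lt

    <-trans : Transitive _<_
    <-trans (x , fx<gx , f≡g) (y , gy<hy , g≡h) with δ.compare x y
    ... | tri< x<y _ _ =
      y , subst (ℕ._< _) (sym (f≡g x<y)) gy<hy ,
      λ y<z → trans (f≡g (δ.trans x<y y<z)) (g≡h y<z)
    <-trans {f} {g} {h} (x , fx<gx , f≡g) (y , gy<hy , g≡h) | tri≈ _ x≈y _ =
      x , ℕ.<-trans fx<gx (subst₂ ℕ._<_ (value-≈ g (δ.Eq.sym x≈y)) (value-≈ h (δ.Eq.sym x≈y)) gy<hy) ,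
      λ x<z → trans (f≡g x<z) (g≡h (δ.<-respˡ-≈ x≈y x<z))
    <-trans (x , fx<gx , f≡g) (y , gy<hy , g≡h) | tri> _ _ y<x =
      x , subst (_ ℕ.<_) (g≡h y<x) fx<gx ,
      λ x<z → trans (f≡g x<z) (g≡h (δ.trans y<x x<z))

    <-asym : ∀ {f g} → f < g → ¬ g < f
    <-asym {f} {g} f<g g<f = <-irrefl {f} {f} (λ _ → refl) (<-trans {f} {g} {f} f<g g<f)

    off-support : ∀ f g {y} → ¬ (y ∈ support f ++ support g) → value f y ≡ value g y
    off-support f g {y} y∉ with value f y ℕ.≟ 0 | value g y ℕ.≟ 0
    ... | yes p | yes q = trans p (sym q)
    ... | no ¬p | _     = ⊥-elim (y∉ (∈-++⁺ˡ δ.Eq.setoid (support∋ f ¬p)))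
    ... | yes _ | no ¬q = ⊥-elim (y∉ (∈-++⁺ʳ δ.Eq.setoid (support f) (support∋ g ¬q)))

    compare : Trichotomous _≈_ _<_
    compare f g
      with largest (λ x → value f x ≢ value g x) differ?
             (λ x≈y fx≢gx fy≡gy →
                fx≢gx (trans (value-≈ f x≈y) (trans fy≡gy (sym (value-≈ g x≈y)))))
             (support f ++ support g)
      where
      differ? : ∀ x → Dec (value f x ≢ value g x)
      differ? x with value f x ℕ.≟ value g x
      ... | yes p = no λ ¬p → ¬p p
      ... | no ¬p = yes ¬p
    ... | inj₁ none = tri≈ (<-irrefl {f} {g} f≈g) f≈g (<-irrefl {g} {f} (λ x → sym (f≈g x)))
      where
      f≈g : f ≈ g
      f≈g x with value f x ℕ.≟ value g x
      ... | yes p = p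
      ... | no ¬p = off-support f g λ x∈ → none x∈ ¬p
    ... | inj₂ (x , fx≢gx , max) with ℕ.<-cmp (value f x) (value g x)
    ...   | tri< lt _ _ = tri< f<g (λ f≈g → fx≢gx (f≈g x)) (<-asym {f} {g} f<g)
      where
      f<g : f < g
      f<g = x , lt , λ {y} x<y → above y x<y
        where
        above : ∀ y → x δ.< y → value f y ≡ value g y
        above y x<y with value f y ℕ.≟ value g y
        ... | yes p = p
        ... | no ¬p = off-support f g λ y∈ → max y∈ ¬p x<y
    ...   | tri≈ _ eq _ = ⊥-elim (fx≢gx eq)
    ...   | tri> _ _ gt = tri> (<-asym {g} {f} g<f) (λ f≈g → fx≢gx (f≈g x)) g<f
      where
      g<f : g < f
      g<f = x , gt , λ {y} x<y → above y x<y
        where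
        above : ∀ y → x δ.< y → value g y ≡ value f y
        above y x<y with value g y ℕ.≟ value f y
        ... | yes p = p
        ... | no ¬p = sym (off-support f g λ y∈ → max y∈ (¬p ∘ sym) x<y)

    Below AtMost : δ.Carrier → FinSupp → Set ℓ
    Below d f = ∀ {x} → ¬ x δ.< d → value f x ≡ 0
    AtMost d f = ∀ {x} → d δ.< x → value f x ≡ 0

    restrict : δ.Carrier → FinSupp → FinSupp
    restrict d f = record
      { value    = λ x → cut x (x δ.<? d)
      ; value-≈  = λ {x} {y} x≈y → cut-≈ x≈y (x δ.<? d) (y δ.<? d)
      ; support  = support f
      ; support∋ = λ {x} → cut-∋ x (x δ.<? d)
      }
      where
      cut : ∀ x → Dec (x δ.< d) → ℕ
      cut x (yes _) = value f x
      cut x (no  _) = 0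

      cut-≈ : ∀ {x y} → x δ.≈ y → ∀ p q → cut x p ≡ cut y q
      cut-≈ x≈y (yes p) (yes q) = value-≈ f x≈y
      cut-≈ x≈y (yes p) (no ¬q) = ⊥-elim (¬q (δ.<-respˡ-≈ x≈y p))
      cut-≈ x≈y (no ¬p) (yes q) = ⊥-elim (¬p (δ.<-respˡ-≈ (δ.Eq.sym x≈y) q))
      cut-≈ x≈y (no ¬p) (no ¬q) = refl

      cut-∋ : ∀ x p → cut x p ≢ 0 → x ∈ support f
      cut-∋ x (yes _) = support∋ f
      cut-∋ x (no  _) ≢0 = ⊥-elim (≢0 refl)

    restrict-below : ∀ d f → Below d (restrict d f)
    restrict-below d f {x} x≮d with x δ.<? d
    ... | yes x<d = ⊥-elim (x≮d x<d)
    ... | no _    = refl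

    restrict-value : ∀ d f {x} → x δ.< d → value (restrict d f) x ≡ value f x
    restrict-value d f {x} x<d with x δ.<? d
    ... | yes _  = refl
    ... | no x≮d = ⊥-elim (x≮d x<d)

    acc-leading : ∀ f → (∀ x → value f x ≢ 0 → AtMost x f → Acc _<_ f) → Acc _<_ f
    acc-leading f rec
      with largest (λ x → value f x ≢ 0) nonzero?
             (λ x≈y fx≢0 fy≡0 → fx≢0 (trans (value-≈ f x≈y) fy≡0)) (support f)
      where
      nonzero? : ∀ x → Dec (value f x ≢ 0)
      nonzero? x with value f x ℕ.≟ 0
      ... | yes p = no λ ¬p → ¬p p
      ... | no ¬p = yes ¬p
    ... | inj₁ none = acc λ (x , gx<fx , _) →
      let fx≢0 = ℕ.m<n⇒n≢0 gx<fx in ⊥-elim (none (support∋ f fx≢0) fx≢0)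
    ... | inj₂ (x , fx≢0 , max) = rec x fx≢0 λ {y} x<y → above y x<y
      where
      above : ∀ y → x δ.< y → value f y ≡ 0
      above y x<y with value f y ℕ.≟ 0
      ... | yes p = p
      ... | no ¬p = ⊥-elim (max (support∋ f ¬p) ¬p x<y)

    acc-below : ∀ d → (∀ {e} → e δ.< d → ∀ f → AtMost e f → Acc _<_ f) →
                ∀ f → Below d f → Acc _<_ f
    acc-below d ih f f-below = acc-leading f λ x fx≢0 → lead x fx≢0
      where
      lead : ∀ x → value f x ≢ 0 → AtMost x f → Acc _<_ f
      lead x fx≢0 with x δ.<? d
      ... | yes x<d = ih x<d f
      ... | no  x≮d = ⊥-elim (fx≢0 (f-below x≮d))

    acc-at : ∀ d → (∀ f → Below d f → Acc _<_ f) →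
             ∀ {k} → Acc ℕ._<_ k → ∀ {r} → Acc _<_ r →
             ∀ f → AtMost d f → value f d ≡ k → restrict d f ≈ r → Acc _<_ f
    acc-at d below {k} acck {r} accr f f-atMost fd≡k f≈r =
      acc λ {g} (x , gx<fx , g≡f) → step acck accr g x gx<fx g≡f (δ.compare x d)
      where
      step : Acc ℕ._<_ k → Acc _<_ r → ∀ g x → value g x ℕ.< value f x →
             (∀ {y} → x δ.< y → value g y ≡ value f y) →
             Tri (x δ.< d) (x δ.≈ d) (d δ.< x) → Acc _<_ g
      step _ _ g x gx<fx g≡f (tri> _ _ d<x) = ⊥-elim (ℕ.m<n⇒n≢0 gx<fx (f-atMost d<x))
      step (acc rsk) _ g x gx<fx g≡f (tri≈ _ x≈d _) =
        acc-at d below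
          (rsk (subst₂ ℕ._<_ (value-≈ g x≈d) (trans (value-≈ f x≈d) fd≡k) gx<fx))
          (below (restrict d g) (restrict-below d g))
          g (λ d<y → trans (g≡f (δ.<-respˡ-≈ (δ.Eq.sym x≈d) d<y)) (f-atMost d<y))
          refl (λ _ → refl)
      step acck (acc rsr) g x gx<fx g≡f (tri< x<d _ _) =
        acc-at d below acck (rsr {restrict d g} g′<r)
          g (λ d<y → trans (g≡f (δ.trans x<d d<y)) (f-atMost d<y))
          (trans (g≡f x<d) fd≡k) (λ _ → refl)
        where
        above : ∀ y → x δ.< y → Dec (y δ.< d) → value (restrict d g) y ≡ value r y
        above y x<y (yes y<d) = trans (restrict-value d g y<d)
                                  (trans (g≡f x<y) (trans (sym (restrict-value d f y<d)) (f≈r y)))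
        above y x<y (no y≮d)  = trans (restrict-below d g y≮d)
                                  (trans (sym (restrict-below d f y≮d)) (f≈r y))

        g′<r : restrict d g < r
        g′<r = x , subst₂ ℕ._<_ (sym (restrict-value d g x<d))
                     (trans (sym (restrict-value d f x<d)) (f≈r x)) gx<fx
                 , λ {y} x<y → above y x<y (y δ.<? d)

    acc-atMost : ∀ {d} → Acc δ._<_ d → ∀ f → AtMost d f → Acc _<_ f
    acc-atMost {d} (acc rs) f f-atMost =
      acc-at d below (ℕ.<-wellFounded (value f d))
        (below (restrict d f) (restrict-below d f)) f f-atMost refl (λ _ → refl)
      where
      below : ∀ g → Below d g → Acc _<_ g
      below = acc-below d λ e<d → acc-atMost (rs e<d)

    <-wellFounded : WellFounded _<_
    <-wellFounded f = acc-leading f λ x _ → acc-atMost (δ.wellFounded x) f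

  power : Ordinal ℓ
  power = record
    { strictTotalOrder = record
      { Carrier = FinSupp
      ; _≈_     = _≈_
      ; _<_     = _<_
      ; isStrictTotalOrder = record
        { isStrictPartialOrder = record
          { isEquivalence = record
            { refl  = λ _ → refl
            ; sym   = λ f≈g x → sym (f≈g x)
            ; trans = λ f≈g g≈h x → trans (f≈g x) (g≈h x)
            }
          ; irrefl   = λ {f} {g} → <-irrefl {f} {g}
          ; trans    = λ {f} {g} {h} → <-trans {f} {g} {h}
          ; <-resp-≈ = (λ f≈g (x , lt , eq) →
                          x , subst (_ ℕ.<_) (f≈g x) lt , λ {y} x<y → trans (eq x<y) (f≈g y))
                     , (λ f≈g (x , lt , eq) →
                          x , subst (ℕ._< _) (f≈g x) lt , λ {y} x<y → trans (sym (f≈g y)) (eq x<y))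
          }
        ; compare = compare
        }
      }
    ; wellFounded = <-wellFounded
    }

infix 9 ω^_

ω^_ : Ordinal ℓ → Ordinal ℓ
ω^_ = Power.power

-- ω^δₙ·sₙ + … + ω^δ₁·s₁, where δ₁ and s₁ are the values at zero : Fin n.
cantorSum : ∀ n → (Fin n → Ordinal ℓ) → (Fin n → ℕ) → Ordinal ℓ
cantorSum zero    δ s = fin 0
cantorSum (suc n) δ s = cantorSum n (δ ∘ suc) (s ∘ suc) +ₒ ω^ (δ zero) ·ₒ fin (s zero)

infix 4 _≅_

_≅_ : Preorder c ℓ₁ ℓ₂ → Preorder c′ ℓ₁′ ℓ₂′ → Set _
P ≅ Q = ∃[ f ] IsOrderIsomorphism P._≈_ Q._≈_ P._≲_ Q._≲_ f
  where
  module P = Preorder P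
  module Q = Preorder Q

∏ : (I : Set) → (I → Preorder c ℓ₁ ℓ₂) → Preorder c ℓ₁ ℓ₂
∏ I P = record
  { Carrier = ∀ i → P.Carrier i
  ; _≈_     = λ p q → ∀ i → P._≈_ i (p i) (q i)
  ; _≲_     = λ p q → ∀ i → P._≲_ i (p i) (q i)
  ; isPreorder = record
    { isEquivalence = record
      { refl  = λ i → P.Eq.refl i
      ; sym   = λ p i → P.Eq.sym i (p i)
      ; trans = λ p q i → P.Eq.trans i (p i) (q i)
      }
    ; reflexive = λ p i → P.reflexive i (p i)
    ; trans     = λ p q i → P.trans i (p i) (q i)
    }
  }
  where module P i = Preorder (P i)

infixl 8 _^_

_^_ : Preorder c ℓ₁ ℓ₂ → ℕ → Preorder c ℓ₁ ℓ₂
P ^ k = ∏ (Fin k) λ _ → P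

module Separative (P : Preorder c ℓ₁ ℓ₂) where

  private module P = Preorder P

  infix 4 _≤*_

  _≤*_ : P.Carrier → P.Carrier → Set (c ⊔ ℓ₂)
  p ≤* q = ∀ r → r P.≲ p → ∃[ s ] s P.≲ r × s P.≲ q

  ≤*-refl : Reflexive _≤*_
  ≤*-refl r r≤p = r , P.refl , r≤p

  ≤*-trans : Transitive _≤*_
  ≤*-trans p≤*q q≤*r t t≤p =
    let s , s≤t , s≤q = p≤*q t t≤p
        u , u≤s , u≤r = q≤*r s s≤q
    in u , P.trans u≤s s≤t , u≤r

  sm : Preorder c ℓ₁ (c ⊔ ℓ₂)
  sm = record
    { Carrier = P.Carrier
    ; _≈_     = P._≈_
    ; _≲_     = _≤*_
    ; isPreorder = record
      { isEquivalence = P.isEquivalence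
      ; reflexive     = λ p≈q r r≤p → r , P.refl , P.trans r≤p (P.reflexive p≈q)
      ; trans         = ≤*-trans
      }
    }

  -- The quotient keeps the carrier and coarsens the equality to p ≤* q ≤* p.
  sq : Poset c (c ⊔ ℓ₂) (c ⊔ ℓ₂)
  sq = SymmetricInterior.poset {R = _≤*_} ≤*-refl ≤*-trans

open Separative public using (sm; sq)
open Poset public using (preorder)

module _ (X : Ordinal ℓ) where

  private module X = Ordinal X

  StrictlyIncreasing : (X.Carrier → X.Carrier) → Set ℓ
  StrictlyIncreasing = IsOrderHomomorphism X._≈_ X._≈_ X._<_ X._<_

  _IsImageOf_ : Pred X.Carrier ℓ → (X.Carrier → X.Carrier) → Set ℓ
  A IsImageOf f = ∀ x → A x ⇔ (∃[ y ] f y X.≈ x)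

  IsCopy : Pred X.Carrier ℓ → Set ℓ
  IsCopy A = ∃[ f ] StrictlyIncreasing f × A IsImageOf f

  ℙ : Poset (lsuc ℓ) ℓ ℓ
  ℙ = record
    { Carrier = Σ (Pred X.Carrier ℓ) IsCopy
    ; _≈_     = λ (A , _) (B , _) → A ≐ B
    ; _≤_     = λ (A , _) (B , _) → A ⊆ B
    ; isPartialOrder = record
      { isPreorder = record
        { isEquivalence = record
          { refl  = id , id
          ; sym   = λ (p , q) → q , p
          ; trans = λ (p , q) (r , s) → (r ∘ p) , (q ∘ s)
          }
        ; reflexive = proj₁
        ; trans     = λ p q → q ∘ p
        }
      ; antisym = _,_
      }
    }

{-# OPTIONS --safe #-}

-- A strictly increasing self-map of an ordinal is never below the identity.
-- Hence, when an ordinal is a sum of blocks in which every later block embeds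
-- into any earlier block above any prescribed point, a strictly increasing f
-- maps each block into itself.  Going down from the last block, suppose f sends
-- a point a of block i to a point b of a later block j, which f maps into
-- itself.  Embedding block j into block i above a and applying f sends the whole
-- of block j into block j and below f b, in particular below the identity at
-- the preimage of f b.  Copies of the sum are therefore families of copies of
-- its blocks.  Pointwise addition moves an embedding into ω^ δ above any point.
module Submission where

open import Defs
open import Data.Empty using (⊥-elim)
open import Data.Fin.Base using (Fin; zero; suc; toℕ) renaming (_<_ to _<ᶠ_)
import Data.Fin.Induction as Fin
import Data.Fin.Properties as Fin
open import Data.List.Base using ([]; _∷_; _++_; map)
import Data.List.Membership.Setoid as Membership
open import Data.List.Membership.Setoid.Properties using (∈-++⁺ˡ; ∈-++⁺ʳ; ∈-map⁺; ∈-resp-≈)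
open import Data.List.Relation.Unary.Any using (here)
open import Data.Nat.Base as ℕ using (ℕ; zero; suc; _≤_)
import Data.Nat.Properties as ℕ
open import Data.Product.Base using (Σ; ∃-syntax; _×_; _,_; proj₁; proj₂)
open import Data.Sum.Base using (inj₁; inj₂)
open import Data.Sum.Relation.Binary.LeftOrder using (₁∼₁; ₁∼₂; ₂∼₂)
import Data.Sum.Relation.Binary.Pointwise as ⊎
open import Function.Base using (_∘_; id; flip)
open import Function.Bundles using (mk⇔; module Equivalence)
open import Function.Definitions using (Congruent; Injective)
open import Induction.WellFounded using (WellFounded; Acc; acc)
open import Level using (Level; lift; lower)
open import Relation.Binary.Bundles using (Preorder)
open import Relation.Binary.Construct.Interior.Symmetric using (_,_; lhs≤rhs; rhs≤lhs)
open import Relation.Binary.Definitions using (Trichotomous; DecidableEquality; Tri; tri<; tri≈; tri>)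
open import Relation.Binary.Morphism.Structures using (IsOrderHomomorphism; IsOrderIsomorphism)
open import Relation.Binary.PropositionalEquality.Core using (_≡_; _≢_; refl; sym; trans; cong₂; subst₂) renaming (cong to ≡-cong)
open import Relation.Nullary.Decidable.Core using (Dec; yes; no)
open import Relation.Nullary.Negation.Core using (¬_)

private
  variable
    ℓ c ℓ₁ ℓ₂ c′ ℓ₁′ ℓ₂′ c″ ℓ₁″ ℓ₂″ : Level

-- Order isomorphisms of preorders

module _ (P : Preorder c ℓ₁ ℓ₂) (Q : Preorder c′ ℓ₁′ ℓ₂′) where

  private
    module P = Preorder P
    module Q = Preorder Q

  ≅-intro : (f : P.Carrier → Q.Carrier) (f⁻¹ : Q.Carrier → P.Carrier) →
            Congruent P._≈_ Q._≈_ f → Injective P._≈_ Q._≈_ f →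
            (∀ {x y} → x P.≲ y → f x Q.≲ f y) → (∀ {x y} → f x Q.≲ f y → x P.≲ y) →
            (∀ y → f (f⁻¹ y) Q.≈ y) → P ≅ Q
  ≅-intro f f⁻¹ f-cong f-inj f-mono f-cancel f-f⁻¹ = f , record
    { isOrderMonomorphism = record
      { isOrderHomomorphism = record { cong = f-cong ; mono = f-mono }
      ; injective           = f-inj
      ; cancel              = f-cancel
      }
    ; surjective = λ y → f⁻¹ y , λ z≈ → Q.Eq.trans (f-cong z≈) (f-f⁻¹ y)
    }

  module Iso (iso : P ≅ Q) where

    open IsOrderIsomorphism (proj₂ iso) public using (cong; mono; injective; cancel)

    to : P.Carrier → Q.Carrier
    to = proj₁ iso

    from : Q.Carrier → P.Carrier
    from y = proj₁ (IsOrderIsomorphism.surjective (proj₂ iso) y)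

    to-from : ∀ y → to (from y) Q.≈ y
    to-from y = proj₂ (IsOrderIsomorphism.surjective (proj₂ iso) y) P.Eq.refl

≅-trans : (P : Preorder c ℓ₁ ℓ₂) (Q : Preorder c′ ℓ₁′ ℓ₂′) (R : Preorder c″ ℓ₁″ ℓ₂″) →
          P ≅ Q → Q ≅ R → P ≅ R
≅-trans P Q R P≅Q Q≅R = ≅-intro P R (G.to ∘ F.to) (F.from ∘ G.from)
  (G.cong ∘ F.cong) (F.injective ∘ G.injective) (G.mono ∘ F.mono) (F.cancel ∘ G.cancel)
  λ y → Preorder.Eq.trans R (G.cong (F.to-from (G.from y))) (G.to-from y)
  where
  module F = Iso P Q P≅Q
  module G = Iso Q R Q≅R

∏-cong : (I : Set) (P : I → Preorder c ℓ₁ ℓ₂) (Q : I → Preorder c′ ℓ₁′ ℓ₂′) →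
         (∀ i → P i ≅ Q i) → ∏ I P ≅ ∏ I Q
∏-cong I P Q P≅Q = ≅-intro (∏ I P) (∏ I Q) (λ p i → F.to i (p i)) (λ q i → F.from i (q i))
  (λ p i → F.cong i (p i)) (λ p i → F.injective i (p i))
  (λ p i → F.mono i (p i)) (λ p i → F.cancel i (p i))
  λ q i → F.to-from i (q i)
  where module F i = Iso (P i) (Q i) (P≅Q i)

-- Separative modifications

sq-preorder : Preorder c ℓ₁ ℓ₂ → Preorder c _ _
sq-preorder P = preorder (sq P)

module _ (P : Preorder c ℓ₁ ℓ₂) (Q : Preorder c′ ℓ₁′ ℓ₂′) (P≅Q : P ≅ Q) where

  private
    module P = Preorder P
    module Q = Preorder Q
    open module F = Iso P Q P≅Q using (to; from; to-from; mono; cancel)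

    -- `≤*` is built from `≲` alone, so an isomorphism transports it: the challenge `r` is pulled
    -- back along `from` and the answer `s` is pushed forward along `to`.
    to-mono* : ∀ {p q} → Separative._≤*_ P p q → Separative._≤*_ Q (to p) (to q)
    to-mono* p≤*q r r≤p =
      let r≈ = to-from r
          s , s≤r , s≤q = p≤*q (from r) (cancel (Q.trans (Q.reflexive r≈) r≤p))
      in to s , Q.trans (mono s≤r) (Q.reflexive r≈) , mono s≤q

    to-cancel* : ∀ {p q} → Separative._≤*_ Q (to p) (to q) → Separative._≤*_ P p q
    to-cancel* p≤*q r r≤p =
      let s , s≤r , s≤q = p≤*q (to r) (mono r≤p)
          s≈ = Q.reflexive (to-from s)
      in from s , cancel (Q.trans s≈ s≤r) , cancel (Q.trans s≈ s≤q)

  sm-cong : sm P ≅ sm Q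
  sm-cong = ≅-intro (sm P) (sm Q) to from F.cong F.injective to-mono* to-cancel* to-from

  sq-cong : sq-preorder P ≅ sq-preorder Q
  sq-cong = ≅-intro (sq-preorder P) (sq-preorder Q) to from
    (λ (p , q) → to-mono* p , to-mono* q) (λ (p , q) → to-cancel* p , to-cancel* q)
    to-mono* to-cancel*
    λ y → Preorder.reflexive (sm Q) (to-from y)
        , Preorder.reflexive (sm Q) (Q.Eq.sym (to-from y))

module _ {I : Set} (_≟_ : DecidableEquality I) (P : I → Preorder c ℓ₁ ℓ₂) where

  private
    module P i = Preorder (P i)

    -- The decision is a separate argument so that the lemmas can split on it: `i ≟ i` does not
    -- reduce to `yes refl`.
    replace : (p : ∀ i → P.Carrier i) → ∀ i → P.Carrier i → ∀ j → Dec (i ≡ j) → P.Carrier j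
    replace p i x j (yes refl) = x
    replace p i x j (no _)     = p j

    replace-≲ : ∀ p i x → P._≲_ i x (p i) → ∀ j d → P._≲_ j (replace p i x j d) (p j)
    replace-≲ p i x x≤p j (yes refl) = x≤p
    replace-≲ p i x x≤p j (no _)     = P.refl j

    ≲-replace : ∀ p i x {y} d → P._≲_ i y (replace p i x i d) → P._≲_ i y x
    ≲-replace p i x (yes refl) y≤x = y≤x
    ≲-replace p i x (no i≢i)   _   = ⊥-elim (i≢i refl)

    -- A challenge `r` at coordinate `i` becomes a challenge to the whole tuple by keeping `p`
    -- elsewhere; the answer is then read off at `i`.
    ≤*-proj : ∀ {p q} → Separative._≤*_ (∏ I P) p q → ∀ i → Separative._≤*_ (P i) (p i) (q i)
    ≤*-proj {p} p≤*q i r r≤p =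
      let s , s≤r , s≤q = p≤*q (λ j → replace p i r j (i ≟ j))
                               (λ j → replace-≲ p i r r≤p j (i ≟ j))
      in s i , ≲-replace p i r (i ≟ i) (s≤r i) , s≤q i

    ≤*-tuple : ∀ {p q} → (∀ i → Separative._≤*_ (P i) (p i) (q i)) → Separative._≤*_ (∏ I P) p q
    ≤*-tuple p≤*q r r≤p =
      (λ i → proj₁ (p≤*q i (r i) (r≤p i))) ,
      (λ i → proj₁ (proj₂ (p≤*q i (r i) (r≤p i)))) ,
      (λ i → proj₂ (proj₂ (p≤*q i (r i) (r≤p i))))

  sm-∏ : sm (∏ I P) ≅ ∏ I (sm ∘ P)
  sm-∏ = ≅-intro (sm (∏ I P)) (∏ I (sm ∘ P)) id id id id ≤*-proj ≤*-tuple
    λ p i → P.Eq.refl i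

  sq-∏ : sq-preorder (∏ I P) ≅ ∏ I (sq-preorder ∘ P)
  sq-∏ = ≅-intro (sq-preorder (∏ I P)) (∏ I (sq-preorder ∘ P)) id id
    (λ (p , q) i → ≤*-proj p i , ≤*-proj q i)
    (λ e → ≤*-tuple (λ i → lhs≤rhs (e i)) , ≤*-tuple (λ i → rhs≤lhs (e i)))
    ≤*-proj ≤*-tuple
    λ p i → Preorder.Eq.refl (sq-preorder (P i))

-- Strictly increasing maps

-- Monotonicity turns `f x < x` into `f (f x) < f x`, so the iterates of `f` would descend forever.
noDescent : {A : Set c} {_<_ : A → A → Set ℓ₁} (f : A → A) →
            (∀ {x y} → x < y → f x < f y) → ∀ {x} → Acc _<_ x → ¬ f x < x
noDescent f f-mono (acc rs) fx<x = noDescent f f-mono (rs fx<x) (f-mono fx<x)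

module _ (X Y : Ordinal ℓ) where

  private
    module X = Ordinal X
    module Y = Ordinal Y

  module Increasing (f : X.Carrier → Y.Carrier)
                    (f-hom : IsOrderHomomorphism X._≈_ Y._≈_ X._<_ Y._<_ f) where

    open IsOrderHomomorphism f-hom public using (cong; mono)

    cancel : ∀ {x y} → f x Y.< f y → x X.< y
    cancel {x} {y} fx<fy with X.compare x y
    ... | tri< x<y _ _ = x<y
    ... | tri≈ _ x≈y _ = ⊥-elim (Y.irrefl (cong x≈y) fx<fy)
    ... | tri> _ _ y<x = ⊥-elim (Y.asym (mono y<x) fx<fy)

    injective : ∀ {x y} → f x Y.≈ f y → x X.≈ y
    injective {x} {y} fx≈fy with X.compare x y
    ... | tri< x<y _ _ = ⊥-elim (Y.irrefl fx≈fy (mono x<y))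
    ... | tri≈ _ x≈y _ = x≈y
    ... | tri> _ _ y<x = ⊥-elim (Y.irrefl (Y.Eq.sym fx≈fy) (mono y<x))

  -- By trichotomy, `¬ e x < a` says that `a` is at most `e x`.
  EmbedsAbove : Y.Carrier → Set ℓ
  EmbedsAbove a = Σ (X.Carrier → Y.Carrier) λ e →
    (∀ x y → x X.< y → e x Y.< e y) × (∀ x → ¬ e x Y.< a)

  Embeds : Set ℓ
  Embeds = Σ (X.Carrier → Y.Carrier) λ e → ∀ x y → x X.< y → e x Y.< e y

-- A copy is an arbitrary predicate, with no respect for `≈` built in; it inherits this from the
-- image condition, which is itself stated up to `≈`.
copy-resp-≈ : (X : Ordinal ℓ) ((A , _) : Σ _ (IsCopy X)) →
              ∀ {x y} → Ordinal._≈_ X x y → A x → A y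
copy-resp-≈ X (A , f , _ , image) x≈y Ax =
  let z , fz≈x = Equivalence.to (image _) Ax
  in Equivalence.from (image _) (z , X.Eq.trans fz≈x x≈y)
  where module X = Ordinal X

-- If > is well-founded too, then the identity is the only strictly increasing map.
noetherian⇒fullCopies : (X : Ordinal ℓ) → WellFounded (flip (Ordinal._<_ X)) →
                        ((A , _) : Σ _ (IsCopy X)) → ∀ x → A x
noetherian⇒fullCopies X >-wf (A , f , f-inc , image) x with Ordinal.compare X (f x) x
... | tri< fx<x _ _ = ⊥-elim (noDescent f f.mono (Ordinal.wellFounded X x) fx<x)
  where module f = IsOrderHomomorphism f-inc
... | tri≈ _ fx≈x _ = Equivalence.from (image x) (x , fx≈x)
... | tri> _ _ x<fx = ⊥-elim (noDescent f f.mono (>-wf x) x<fx)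
  where module f = IsOrderHomomorphism f-inc

fullCopy : (X : Ordinal ℓ) → Σ _ (IsCopy X)
fullCopy X = (λ x → ∃[ y ] y X.≈ x) , id , record { cong = id ; mono = id } , λ x → mk⇔ id id
  where module X = Ordinal X

-- Sums of blocks

-- This presents `X` as the ordered sum of the `B i` along `≺`. Injections that cover `X` let the
-- nested sums of a Cantor normal form share one flat index type.
record Blocks (X : Ordinal ℓ) {I : Set} (_≺_ : I → I → Set) (B : I → Ordinal ℓ) : Set ℓ where

  private
    module X = Ordinal X
    module B i = Ordinal (B i)

  field
    inj      : ∀ i → B.Carrier i → X.Carrier
    inj-hom  : ∀ i → IsOrderHomomorphism (B._≈_ i) X._≈_ (B._<_ i) X._<_ (inj i)
    inj-≺    : ∀ {i j} → i ≺ j → ∀ a b → inj i a X.< inj j b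
    locate   : ∀ x → ∃[ i ] ∃[ a ] inj i a X.≈ x

Blocks-resp-≃ₒ : (X Y : Ordinal ℓ) {I : Set} {_≺_ : I → I → Set} {B : I → Ordinal ℓ} →
                 X ≃ₒ Y → Blocks Y _≺_ B → Blocks X _≺_ B
Blocks-resp-≃ₒ X Y {_≺_ = _≺_} {B} (f , f-iso) blocks = record
  { inj     = λ i a → f⁻¹ (inj i a)
  ; inj-hom = λ i → record
    { cong = λ a≈b → f⁻¹-cong (IsOrderHomomorphism.cong (inj-hom i) a≈b)
    ; mono = λ a<b → f⁻¹-mono (IsOrderHomomorphism.mono (inj-hom i) a<b)
    }
  ; inj-≺   = λ i≺j a b → f⁻¹-mono (inj-≺ i≺j a b)
  ; locate  = λ x → let i , a , a≈fx = locate (f x) in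
      i , a , f.injective (Y.Eq.trans (f-f⁻¹ _) a≈fx)
  }
  where
  module X = Ordinal X
  module Y = Ordinal Y
  module f = IsOrderIsomorphism f-iso
  open Blocks blocks

  f⁻¹ : Y.Carrier → X.Carrier
  f⁻¹ y = proj₁ (f.surjective y)

  f-f⁻¹ : ∀ y → f (f⁻¹ y) Y.≈ y
  f-f⁻¹ y = proj₂ (f.surjective y) X.Eq.refl

  f⁻¹-cong : ∀ {x y} → x Y.≈ y → f⁻¹ x X.≈ f⁻¹ y
  f⁻¹-cong x≈y = f.injective (Y.Eq.trans (f-f⁻¹ _) (Y.Eq.trans x≈y (Y.Eq.sym (f-f⁻¹ _))))

  f⁻¹-mono : ∀ {x y} → x Y.< y → f⁻¹ x X.< f⁻¹ y
  f⁻¹-mono x<y =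
    f.cancel (Y.<-respˡ-≈ (Y.Eq.sym (f-f⁻¹ _)) (Y.<-respʳ-≈ (Y.Eq.sym (f-f⁻¹ _)) x<y))

module _ {I : Set} {_≺_ : I → I → Set}
         (≺-cmp : Trichotomous _≡_ _≺_) (≻-wf : WellFounded (flip _≺_))
         (X : Ordinal ℓ) (B : I → Ordinal ℓ) (blocks : Blocks X _≺_ B)
         (absorb : ∀ {i j} → i ≺ j → ∀ a → EmbedsAbove (B j) (B i) a)
         where

  private
    module X = Ordinal X
    module B i = Ordinal (B i)
    open Blocks blocks
    module inj i = Increasing (B i) X (inj i) (inj-hom i)

    ≈⇒≡ : ∀ {i j a b} → inj i a X.≈ inj j b → i ≡ j
    ≈⇒≡ {i} {j} a≈b with ≺-cmp i j
    ... | tri< i≺j _ _ = ⊥-elim (X.irrefl a≈b (inj-≺ i≺j _ _))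
    ... | tri≈ _ i≡j _ = i≡j
    ... | tri> _ _ j≺i = ⊥-elim (X.irrefl (X.Eq.sym a≈b) (inj-≺ j≺i _ _))

  -- Strictly increasing maps preserve the blocks

  module _ (f : X.Carrier → X.Carrier) (f-inc : StrictlyIncreasing X f) where

    private
      module f = Increasing X X f f-inc

      Stays : I → Set ℓ
      Stays i = ∀ a → ∃[ b ] inj i b X.≈ f (inj i a)

      noOvertaking : ∀ {i j} → i ≺ j → Stays j → ∀ a b → ¬ inj j b X.≈ f (inj i a)
      noOvertaking {i} {j} i≺j stays-j a b b≈fa =
        -- `below` bounds every value of `h` by `f (inj j b)`, whose coordinate in block `j` is `d`;
        -- at `d` itself this bound reads `g d < d`.
        noDescent g g-mono (B.wellFounded j d) (inj.cancel j
          (X.<-respˡ-≈ (X.Eq.sym (g-≈ d)) (X.<-respʳ-≈ (X.Eq.sym d≈fb) (below d))))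
        where
        e = proj₁ (absorb i≺j a)
        e-mono = proj₁ (proj₂ (absorb i≺j a))
        e-above = proj₂ (proj₂ (absorb i≺j a))

        d = proj₁ (stays-j b)
        d≈fb = proj₂ (stays-j b)

        h : B.Carrier j → X.Carrier
        h x = f (inj i (e x))

        below : ∀ x → h x X.< f (inj j b)
        below x = f.mono (inj-≺ i≺j (e x) b)

        -- `e x` is not below `a`, so `h x` is not below `f (inj i a)`, which is `inj j b`.
        h-above : ∀ x → ¬ h x X.< inj j b
        h-above x hx<b = e-above x (inj.cancel i (f.cancel (X.<-respʳ-≈ b≈fa hx<b)))

        -- `h x` is squeezed between two points of block `j`: it is not below `inj j b`, and it is
        -- below `f (inj j b)`, which is `inj j d`.
        h-stays : ∀ x → ∃[ y ] inj j y X.≈ h x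
        h-stays x with locate (h x)
        ... | k , y , y≈hx with ≺-cmp k j
        ...   | tri< k≺j _ _ = ⊥-elim (h-above x (X.<-respˡ-≈ y≈hx (inj-≺ k≺j y b)))
        ...   | tri≈ _ refl _ = y , y≈hx
        ...   | tri> _ _ j≺k = ⊥-elim (X.asym (below x)
          (X.<-respˡ-≈ d≈fb (X.<-respʳ-≈ y≈hx (inj-≺ j≺k d y))))

        g : B.Carrier j → B.Carrier j
        g x = proj₁ (h-stays x)

        g-≈ : ∀ x → inj j (g x) X.≈ h x
        g-≈ x = proj₂ (h-stays x)

        g-mono : ∀ {x y} → B._<_ j x y → B._<_ j (g x) (g y)
        g-mono {x} {y} x<y = inj.cancel j (X.<-respˡ-≈ (X.Eq.sym (g-≈ x))
          (X.<-respʳ-≈ (X.Eq.sym (g-≈ y)) (f.mono (inj.mono i (e-mono x y x<y)))))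

      stays : ∀ {i} → Acc (flip _≺_) i → Stays i
      stays {i} (acc later) a with locate (f (inj i a))
      ... | j , b , b≈fa with ≺-cmp i j
      ...   | tri< i≺j _ _ = ⊥-elim (noOvertaking i≺j (stays (later i≺j)) a b b≈fa)
      ...   | tri≈ _ refl _ = b , b≈fa
      -- Landing in an earlier block would put `f` below the identity at `inj i a`.
      ...   | tri> _ _ j≺i = ⊥-elim (noDescent f f.mono (X.wellFounded _)
        (X.<-respˡ-≈ b≈fa (inj-≺ j≺i b a)))

    blockMap : ∀ i → B.Carrier i → B.Carrier i
    blockMap i a = proj₁ (stays (≻-wf i) a)

    blockMap-≈ : ∀ i a → inj i (blockMap i a) X.≈ f (inj i a)
    blockMap-≈ i a = proj₂ (stays (≻-wf i) a)

    blockMap-inc : ∀ i → StrictlyIncreasing (B i) (blockMap i)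
    blockMap-inc i = record
      { cong = λ {a} {b} a≈b → inj.injective i (X.Eq.trans (blockMap-≈ i a)
          (X.Eq.trans (f.cong (inj.cong i a≈b)) (X.Eq.sym (blockMap-≈ i b))))
      ; mono = λ {a} {b} a<b → inj.cancel i (X.<-respˡ-≈ (X.Eq.sym (blockMap-≈ i a))
          (X.<-respʳ-≈ (X.Eq.sym (blockMap-≈ i b)) (f.mono (inj.mono i a<b))))
      }

  -- Copies of a sum as families of copies of its blocks

  private
    -- The trace of the image of `f` on block `i` is the image of `blockMap i`: as `f` keeps every
    -- point in its block, a preimage of a point of block `i` lies in block `i` as well.
    split : Σ _ (IsCopy X) → ∀ i → Σ _ (IsCopy (B i))
    split (A , f , f-inc , image) i =
      (λ a → A (inj i a)) , blockMap f f-inc i , blockMap-inc f f-inc i , λ a → mk⇔ to (from a)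
      where
      to : ∀ {a} → A (inj i a) → ∃[ b ] B._≈_ i (blockMap f f-inc i b) a
      to {a} Aa with Equivalence.to (image (inj i a)) Aa
      ... | y , fy≈a with locate y
      ...   | j , b , b≈y with ≈⇒≡ (X.Eq.trans (blockMap-≈ f f-inc j b) fb≈a)
        where
        fb≈a : f (inj j b) X.≈ inj i a
        fb≈a = X.Eq.trans (IsOrderHomomorphism.cong f-inc b≈y) fy≈a
      ...     | refl = b , inj.injective i (X.Eq.trans (blockMap-≈ f f-inc i b)
                             (X.Eq.trans (IsOrderHomomorphism.cong f-inc b≈y) fy≈a))

      from : ∀ a → ∃[ b ] B._≈_ i (blockMap f f-inc i b) a → A (inj i a)
      from a (b , fb≈a) = Equivalence.from (image (inj i a))
        (inj i b , X.Eq.trans (X.Eq.sym (blockMap-≈ f f-inc i b)) (inj.cong i fb≈a))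

    module _ (C : ∀ i → Σ _ (IsCopy (B i))) where

      glueMap : X.Carrier → X.Carrier
      glueMap x = let i , a , _ = locate x in inj i (proj₁ (proj₂ (C i)) a)

      glueMap-inc : StrictlyIncreasing X glueMap
      glueMap-inc = record { cong = glue-cong _ _ ; mono = glue-mono _ _ }
        where
        -- `locate` need not respect `≈`, but equal points have the same index by `≈⇒≡`, and then
        -- equal coordinates because `inj i` is injective.
        glue-cong : ∀ x y → x X.≈ y → glueMap x X.≈ glueMap y
        glue-cong x y x≈y with locate x | locate y
        ... | i , a , a≈x | j , b , b≈y
          with a≈b ← X.Eq.trans a≈x (X.Eq.trans x≈y (X.Eq.sym b≈y)) with ≈⇒≡ a≈b
        ... | refl = inj.cong i
          (IsOrderHomomorphism.cong (proj₁ (proj₂ (proj₂ (C i)))) (inj.injective i a≈b))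

        glue-mono : ∀ x y → x X.< y → glueMap x X.< glueMap y
        glue-mono x y x<y with locate x | locate y
        ... | i , a , a≈x | j , b , b≈y
          with a<b ← X.<-respˡ-≈ (X.Eq.sym a≈x) (X.<-respʳ-≈ (X.Eq.sym b≈y) x<y) with ≺-cmp i j
        ...   | tri< i≺j _ _ = inj-≺ i≺j _ _
        ...   | tri≈ _ refl _ = inj.mono i
          (IsOrderHomomorphism.mono (proj₁ (proj₂ (proj₂ (C i)))) (inj.cancel i a<b))
        ...   | tri> _ _ j≺i = ⊥-elim (X.asym a<b (inj-≺ j≺i b a))

      glueMap-inj : ∀ i a → glueMap (inj i a) X.≈ inj i (proj₁ (proj₂ (C i)) a)
      glueMap-inj i a with locate (inj i a)
      ... | j , b , b≈a with ≈⇒≡ b≈a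
      ...   | refl = inj.cong i
        (IsOrderHomomorphism.cong (proj₁ (proj₂ (proj₂ (C i)))) (inj.injective i b≈a))

      -- Membership goes through `C i` and not through `glueMap`, so that comparing the trace on a
      -- block with the given copy only takes disjointness of the blocks.
      Glue : X.Carrier → Set _
      Glue x = ∃[ i ] ∃[ a ] inj i a X.≈ x × proj₁ (C i) a

      glue : Σ _ (IsCopy X)
      glue = Glue , glueMap , glueMap-inc , λ x → mk⇔
        (λ (i , a , a≈x , Ca) →
          let b , fb≈a = Equivalence.to (proj₂ (proj₂ (proj₂ (C i))) a) Ca
          in inj i b , X.Eq.trans (glueMap-inj i b) (X.Eq.trans (inj.cong i fb≈a) a≈x))
        λ (y , fy≈x) → let i , a , _ = locate y in
          i , proj₁ (proj₂ (C i)) a , fy≈x ,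
          Equivalence.from (proj₂ (proj₂ (proj₂ (C i))) _) (a , B.Eq.refl i)

      Glue-inj : ∀ i {a} → Glue (inj i a) → proj₁ (C i) a
      Glue-inj i (j , b , b≈a , Cb) with ≈⇒≡ b≈a
      ... | refl = copy-resp-≈ (B i) (C i) (inj.injective i b≈a) Cb

    -- The blocks cover `X` only up to `≈`, so `copy-resp-≈` moves membership to the located point
    -- and back.
    ⊆-unsplit : ∀ A A′ → (∀ i {a} → proj₁ A (inj i a) → proj₁ A′ (inj i a)) →
                ∀ {x} → proj₁ A x → proj₁ A′ x
    ⊆-unsplit A A′ A⊆A′ {x} Ax =
      let i , a , a≈x = locate x
      in copy-resp-≈ X A′ a≈x (A⊆A′ i (copy-resp-≈ X A (X.Eq.sym a≈x) Ax))

  ℙ-blocks : preorder (ℙ X) ≅ ∏ I (preorder ∘ ℙ ∘ B)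
  ℙ-blocks = ≅-intro (preorder (ℙ X)) (∏ I (preorder ∘ ℙ ∘ B)) split glue
    (λ (p , q) i → p , q)
    (λ {A} {A′} e → (λ {x} → ⊆-unsplit A A′ (λ i → proj₁ (e i)) {x})
                  , (λ {x} → ⊆-unsplit A′ A (λ i → proj₂ (e i)) {x}))
    (λ p i → p)
    (λ {A} {A′} p {x} → ⊆-unsplit A A′ (λ i → p i) {x})
    λ C i → (λ {a} → Glue-inj C i) , λ {a} Ca → i , a , X.Eq.refl , Ca

-- Powers of ω

module _ (δ : Ordinal ℓ) where

  private
    module δ = Ordinal δ
    module ω^δ = Ordinal (ω^ δ)
  open Power δ
  open FinSupp
  open Membership δ.Eq.setoid using (_∈_)

  infixl 6 _⊕_

  -- This is the natural (Hessenberg) sum: coefficients of equal powers add up, with no comparison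
  -- of leading exponents.
  _⊕_ : FinSupp → FinSupp → FinSupp
  f ⊕ g = record
    { value    = λ x → value f x ℕ.+ value g x
    ; value-≈  = λ x≈y → cong₂ ℕ._+_ (value-≈ f x≈y) (value-≈ g x≈y)
    ; support  = support f ++ support g
    ; support∋ = λ {x} → ∋ x
    }
    where
    ∋ : ∀ x → value f x ℕ.+ value g x ≢ 0 → x ∈ support f ++ support g
    ∋ x f+g≢0 with value f x ℕ.≟ 0
    ... | no  fx≢0 = ∈-++⁺ˡ δ.Eq.setoid (support∋ f fx≢0)
    ... | yes fx≡0 = ∈-++⁺ʳ δ.Eq.setoid (support f)
      (support∋ g λ gx≡0 → f+g≢0 (cong₂ ℕ._+_ fx≡0 gx≡0))

  ⊕-monoʳ-< : ∀ f g h → g < h → (f ⊕ g) < (f ⊕ h)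
  ⊕-monoʳ-< f g h (x , gx<hx , g≡h) =
    x , ℕ.+-monoʳ-< (value f x) gx<hx , λ {y} x<y → ≡-cong (value f y ℕ.+_) (g≡h x<y)

  -- No coefficient of the sum is smaller than that of `f`, so no argument can witness `<`.
  ⊕≮ˡ : ∀ f g → ¬ (f ⊕ g) < f
  ⊕≮ˡ f g (x , lt , _) = ℕ.m+n≮m (value f x) (value g x) lt

  embedsAbove : (X : Ordinal ℓ) → Embeds X (ω^ δ) → ∀ f → EmbedsAbove X (ω^ δ) f
  embedsAbove X (e , e-mono) f =
    (λ x → f ⊕ e x) , (λ x y x<y → ⊕-monoʳ-< f (e x) (e y) (e-mono x y x<y)) , λ x → ⊕≮ˡ f (e x)

  -- The ordinal `ω^d · k`. For `k = 0` the list `d ∷ []` is still a legitimate support, since a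
  -- support may contain zeros of the function.
  monomial : δ.Carrier → ℕ → FinSupp
  monomial d k = record
    { value    = λ x → at (x δ.≟ d)
    ; value-≈  = λ {x} {y} x≈y → at-≈ x≈y (x δ.≟ d) (y δ.≟ d)
    ; support  = d ∷ []
    ; support∋ = λ {x} → at-∋ (x δ.≟ d)
    }
    where
    at : ∀ {x} → Dec (x δ.≈ d) → ℕ
    at (yes _) = k
    at (no  _) = 0

    at-≈ : ∀ {x y} → x δ.≈ y → (p : Dec (x δ.≈ d)) (q : Dec (y δ.≈ d)) → at p ≡ at q
    at-≈ x≈y (yes _) (yes _) = refl
    at-≈ x≈y (yes p) (no ¬q) = ⊥-elim (¬q (δ.Eq.trans (δ.Eq.sym x≈y) p))
    at-≈ x≈y (no ¬p) (yes q) = ⊥-elim (¬p (δ.Eq.trans x≈y q))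
    at-≈ x≈y (no _)  (no _)  = refl

    at-∋ : ∀ {x} (p : Dec (x δ.≈ d)) → at p ≢ 0 → x ∈ d ∷ []
    at-∋ (yes x≈d) _  = here x≈d
    at-∋ (no _)   ≢0 = ⊥-elim (≢0 refl)

  monomial-mono : ∀ d k l → k ℕ.< l → monomial d k < monomial d l
  monomial-mono d k l k<l = d , at-d , λ {y} → above y
    where
    at-d : value (monomial d k) d ℕ.< value (monomial d l) d
    at-d with d δ.≟ d
    ... | yes _  = k<l
    ... | no d≉d = ⊥-elim (d≉d δ.Eq.refl)

    above : ∀ y → d δ.< y → value (monomial d k) y ≡ value (monomial d l) y
    above y d<y with y δ.≟ d
    ... | yes y≈d = ⊥-elim (δ.irrefl (δ.Eq.sym y≈d) d<y)
    ... | no _    = refl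

  fin-embeds : δ.Carrier → ∀ m → Embeds (fin m) (ω^ δ)
  fin-embeds d m =
    (λ k → monomial d (toℕ (lower k))) , λ _ _ (lift k<l) → monomial-mono d _ _ k<l

module _ (δ ε : Ordinal ℓ) (δ<ε : δ <ₒ ε) where

  private
    module δ = Ordinal δ
    module ε = Ordinal ε
    module ω^δ = Power δ
    module ω^ε = Power ε
    d = proj₁ δ<ε
    e = proj₁ (proj₂ δ<ε)
    module e = IsOrderIsomorphism (proj₂ (proj₂ δ<ε))
    open Power.FinSupp
    open Membership ε.Eq.setoid using (_∈_)

    e⁻¹ : Ordinal.Carrier (ε ↓ d) → δ.Carrier
    e⁻¹ y = proj₁ (e.surjective y)

    e-e⁻¹ : ∀ y → proj₁ (e (e⁻¹ y)) ε.≈ proj₁ y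
    e-e⁻¹ y = proj₂ (e.surjective y) δ.Eq.refl

    -- Extension by zero from the initial segment `ε ↓ d`, which `e` identifies with `δ`.
    extend : (f : ω^δ.FinSupp) → ∀ {x} → Dec (x ε.< d) → ℕ
    extend f {x} (yes x<d) = value f (e⁻¹ (x , x<d))
    extend f     (no  _)   = 0

    -- Different proofs of `x < d` are harmless because `ε ↓ d` compares first components only.
    extend-≈ : ∀ f {x y} → x ε.≈ y → (p : Dec (x ε.< d)) (q : Dec (y ε.< d)) →
               extend f p ≡ extend f q
    extend-≈ f x≈y (yes p) (yes q) = value-≈ f
      (e.injective (ε.Eq.trans (e-e⁻¹ _) (ε.Eq.trans x≈y (ε.Eq.sym (e-e⁻¹ _)))))
    extend-≈ f x≈y (yes p) (no ¬q) = ⊥-elim (¬q (ε.<-respˡ-≈ x≈y p))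
    extend-≈ f x≈y (no ¬p) (yes q) = ⊥-elim (¬p (ε.<-respˡ-≈ (ε.Eq.sym x≈y) q))
    extend-≈ f x≈y (no _)  (no _)  = refl

    push : ω^δ.FinSupp → ω^ε.FinSupp
    push f = record
      { value    = λ x → extend f (x ε.<? d)
      ; value-≈  = λ {x} {y} x≈y → extend-≈ f x≈y (x ε.<? d) (y ε.<? d)
      ; support  = map (proj₁ ∘ e) (support f)
      ; support∋ = λ {x} → extend-∋ (x ε.<? d)
      }
      where
      extend-∋ : ∀ {x} (p : Dec (x ε.< d)) → extend f p ≢ 0 → x ∈ map (proj₁ ∘ e) (support f)
      extend-∋ (yes p) ≢0 = ∈-resp-≈ ε.Eq.setoid (e-e⁻¹ _)
        (∈-map⁺ δ.Eq.setoid ε.Eq.setoid e.cong (support∋ f ≢0))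
      extend-∋ (no _)  ≢0 = ⊥-elim (≢0 refl)

    extend-e : ∀ f x (p : Dec (proj₁ (e x) ε.< d)) → extend f p ≡ value f x
    extend-e f x (yes p) = value-≈ f (e.injective (e-e⁻¹ _))
    extend-e f x (no ¬p) = ⊥-elim (¬p (proj₂ (e x)))

  -- The largest argument `x` where `f` and `g` differ becomes `e x`: beyond it, points of the
  -- segment come from points above `x`, and outside the segment both extensions vanish.
  ω^-embeds : Embeds (ω^ δ) (ω^ ε)
  ω^-embeds = push , mono
    where
    mono : ∀ f g → f ω^δ.< g → push f ω^ε.< push g
    mono f g (x , fx<gx , f≡g) =
      proj₁ (e x) ,
      subst₂ ℕ._<_ (sym (extend-e f x (_ ε.<? d))) (sym (extend-e g x (_ ε.<? d))) fx<gx ,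
      λ {y} ex<y → above ex<y (y ε.<? d)
      where
      above : ∀ {y} → proj₁ (e x) ε.< y → (p : Dec (y ε.< d)) → extend f p ≡ extend g p
      above ex<y (yes p) = f≡g (e.cancel (ε.<-respʳ-≈ (ε.Eq.sym (e-e⁻¹ _)) ex<y))
      above ex<y (no _)  = refl

-- Cantor normal forms

module _ {n : ℕ} (s : Fin n → ℕ) where

  -- The finite tail is the single block `rest` and not `m` singletons: only the tail as a whole has
  -- to embed into the powers of ω before it.
  data Index : Set where
    block : ∀ i → Fin (s i) → Index
    rest  : Index

  -- From left to right in the Cantor normal form, so that larger exponents come first.
  data _≺_ : Index → Index → Set where
    major : ∀ {i j k l} → j <ᶠ i → block i k ≺ block j l
    minor : ∀ {i k l} → k <ᶠ l → block i k ≺ block i l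
    last  : ∀ {i k} → block i k ≺ rest

  ≺-irrefl : ∀ {x} → ¬ x ≺ x
  ≺-irrefl (major i<i) = Fin.<-irrefl refl i<i
  ≺-irrefl (minor k<k) = Fin.<-irrefl refl k<k

  ≺-asym : ∀ {x y} → x ≺ y → ¬ y ≺ x
  ≺-asym (major j<i) (major i<j) = Fin.<-asym j<i i<j
  ≺-asym (major j<i) (minor _)   = Fin.<-irrefl refl j<i
  ≺-asym (minor _)   (major i<i) = Fin.<-irrefl refl i<i
  ≺-asym (minor k<l) (minor l<k) = Fin.<-asym k<l l<k

  ≺⇒tri : ∀ {x y} → x ≺ y → Tri (x ≺ y) (x ≡ y) (y ≺ x)
  ≺⇒tri x≺y = tri< x≺y (λ { refl → ≺-irrefl x≺y }) (≺-asym x≺y)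

  ≻⇒tri : ∀ {x y} → y ≺ x → Tri (x ≺ y) (x ≡ y) (y ≺ x)
  ≻⇒tri y≺x = tri> (≺-asym y≺x) (λ { refl → ≺-irrefl y≺x }) y≺x

  ≺-cmp : Trichotomous _≡_ _≺_
  ≺-cmp rest rest = tri≈ ≺-irrefl refl ≺-irrefl
  ≺-cmp rest (block _ _) = ≻⇒tri last
  ≺-cmp (block _ _) rest = ≺⇒tri last
  ≺-cmp (block i k) (block j l) with Fin.<-cmp i j
  ... | tri< i<j _ _ = ≻⇒tri (major i<j)
  ... | tri> _ _ j<i = ≺⇒tri (major j<i)
  ... | tri≈ _ refl _ with Fin.<-cmp k l
  ...   | tri< k<l _ _  = ≺⇒tri (minor k<l)
  ...   | tri≈ _ refl _ = tri≈ ≺-irrefl refl ≺-irrefl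
  ...   | tri> _ _ l<k  = ≻⇒tri (minor l<k)

  -- The order is lexicographic: along `≺` either `i` drops, and `k` starts afresh, or `i` is kept
  -- and `k` climbs inside the finite `Fin (s i)`.
  ≻-wf : WellFounded (flip _≺_)
  ≻-wf rest        = acc λ ()
  ≻-wf (block i k) = acc (later (Fin.<-wellFounded i) (Fin.>-wellFounded k))
    where
    later : ∀ {i} → Acc _<ᶠ_ i → ∀ {k} → Acc (flip _<ᶠ_) k →
            ∀ {y} → block i k ≺ y → Acc (flip _≺_) y
    later (acc ri) ak (major j<i) = acc (later (ri j<i) (Fin.>-wellFounded _))
    later ai (acc rk) (minor k<l) = acc (later ai (rk k<l))
    later ai ak       last        = ≻-wf rest

  term : (δ : Fin n → Ordinal ℓ) → ℕ → Index → Ordinal ℓ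
  term δ m (block i _) = ω^ (δ i)
  term δ m rest        = fin m

-- Locating the blocks inside a Cantor sum

module _ {ℓ : Level} where

  -- `cantorSum` puts the smallest exponent, at index `zero`, rightmost; hence `zero` goes to
  -- `inj₂`.
  position : ∀ n (δ : Fin n → Ordinal ℓ) s i → Fin (s i) →
             Ordinal.Carrier (ω^ (δ i)) → Ordinal.Carrier (cantorSum n δ s)
  position (suc n) δ s zero    k z = inj₂ (lift k , z)
  position (suc n) δ s (suc i) k z = inj₁ (position n (δ ∘ suc) (s ∘ suc) i k z)

  position-hom : ∀ n (δ : Fin n → Ordinal ℓ) s i k →
    IsOrderHomomorphism (Ordinal._≈_ (ω^ (δ i))) (Ordinal._≈_ (cantorSum n δ s))
                        (Ordinal._<_ (ω^ (δ i))) (Ordinal._<_ (cantorSum n δ s))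
                        (position n δ s i k)
  position-hom (suc n) δ s zero k = record
    { cong = λ z≈w → ⊎.inj₂ (lift refl , z≈w)
    ; mono = λ z<w → ₂∼₂ (inj₂ (lift refl , z<w))
    }
  position-hom (suc n) δ s (suc i) k = record
    { cong = λ z≈w → ⊎.inj₁ (IH.cong z≈w)
    ; mono = λ z<w → ₁∼₁ (IH.mono z<w)
    }
    where module IH = IsOrderHomomorphism (position-hom n (δ ∘ suc) (s ∘ suc) i k)

  position-major : ∀ n (δ : Fin n → Ordinal ℓ) s {i j k l} → j <ᶠ i → ∀ z w →
    Ordinal._<_ (cantorSum n δ s) (position n δ s i k z) (position n δ s j l w)
  position-major (suc n) δ s {suc i} {zero}  j<i z w = ₁∼₂
  position-major (suc n) δ s {suc i} {suc j} j<i z w =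
    ₁∼₁ (position-major n (δ ∘ suc) (s ∘ suc) (ℕ.s<s⁻¹ j<i) z w)

  position-minor : ∀ n (δ : Fin n → Ordinal ℓ) s {i k l} → k <ᶠ l → ∀ z w →
    Ordinal._<_ (cantorSum n δ s) (position n δ s i k z) (position n δ s i l w)
  position-minor (suc n) δ s {zero}  k<l z w = ₂∼₂ (inj₁ (lift k<l))
  position-minor (suc n) δ s {suc i} k<l z w =
    ₁∼₁ (position-minor n (δ ∘ suc) (s ∘ suc) k<l z w)

  position-locate : ∀ n (δ : Fin n → Ordinal ℓ) s x →
    ∃[ i ] ∃[ k ] ∃[ z ] position n δ s i k z ≡ x
  position-locate zero    δ s (lift ())
  position-locate (suc n) δ s (inj₂ (lift k , z)) = zero , k , z , refl
  position-locate (suc n) δ s (inj₁ x) =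
    let i , k , z , eq = position-locate n (δ ∘ suc) (s ∘ suc) x
    in suc i , k , z , ≡-cong inj₁ eq

  cantorBlocks : ∀ n (δ : Fin n → Ordinal ℓ) s m →
                 Blocks (cantorSum n δ s +ₒ fin m) (_≺_ s) (term s δ m)
  cantorBlocks n δ s m = record
    { inj     = inj
    ; inj-hom = inj-hom
    ; inj-≺   = inj-≺
    ; locate  = locate
    }
    where
    module Sum = Ordinal (cantorSum n δ s +ₒ fin m)

    inj : ∀ i → Ordinal.Carrier (term s δ m i) → Sum.Carrier
    inj (block i k) z = inj₁ (position n δ s i k z)
    inj rest        j = inj₂ j

    inj-hom : ∀ i → IsOrderHomomorphism (Ordinal._≈_ (term s δ m i)) Sum._≈_
                                        (Ordinal._<_ (term s δ m i)) Sum._<_ (inj i)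
    inj-hom (block i k) = record
      { cong = λ z≈w → ⊎.inj₁ (P.cong z≈w) ; mono = λ z<w → ₁∼₁ (P.mono z<w) }
      where module P = IsOrderHomomorphism (position-hom n δ s i k)
    inj-hom rest = record { cong = ⊎.inj₂ ; mono = ₂∼₂ }

    inj-≺ : ∀ {i j} → _≺_ s i j → ∀ a b → inj i a Sum.< inj j b
    inj-≺ (major j<i) z w = ₁∼₁ (position-major n δ s j<i z w)
    inj-≺ (minor k<l) z w = ₁∼₁ (position-minor n δ s k<l z w)
    inj-≺ last        z j = ₁∼₂

    locate : ∀ x → ∃[ i ] ∃[ a ] inj i a Sum.≈ x
    locate (inj₂ j) = rest , j , Sum.Eq.refl
    locate (inj₁ x) with position-locate n δ s x
    ... | i , k , z , refl = block i k , z , Sum.Eq.refl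

  -- Absorption between blocks and removal of the finite tail

  module _ {n : ℕ} (δ : Fin n → Ordinal ℓ) (s : Fin n → ℕ) (m : ℕ) where

    private
      T : Index s → Ordinal ℓ
      T = term s δ m

    term-absorb : (∀ i → fin 0 <ₒ δ i) → (∀ i j → i <ᶠ j → δ i <ₒ δ j) →
                  ∀ {i j} → _≺_ s i j → ∀ a → EmbedsAbove (T j) (T i) a
    term-absorb δ>0 δ-inc (major {i} {j} j<i) =
      embedsAbove (δ i) (ω^ (δ j)) (ω^-embeds (δ j) (δ i) (δ-inc j i j<i))
    term-absorb δ>0 δ-inc (minor {i} _) = embedsAbove (δ i) (ω^ (δ i)) (id , λ _ _ z<w → z<w)
    -- A proof of `fin 0 <ₒ δ i` has an element of `δ i` as its first component; it serves as the
    -- exponent of the monomials.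
    term-absorb δ>0 δ-inc (last {i}) =
      embedsAbove (δ i) (fin m) (fin-embeds (δ i) (proj₁ (δ>0 i)) m)

    ℙ-curry : ∏ (Index s) (preorder ∘ ℙ ∘ T) ≅
              ∏ (Fin n) (λ i → preorder (ℙ (ω^ (δ i))) ^ s i)
    ℙ-curry = ≅-intro (∏ (Index s) (preorder ∘ ℙ ∘ T))
                      (∏ (Fin n) (λ i → preorder (ℙ (ω^ (δ i))) ^ s i))
      (λ C i k → C (block i k)) uncurried
      (λ e i k → e (block i k))
      (λ {C} {D} e → λ { (block i k) → e i k
                       ; rest → (λ _ → full (D rest) _) , (λ _ → full (C rest) _) })
      (λ p i k → p (block i k))
      (λ {C} {D} p → λ { (block i k) → p i k ; rest → λ _ → full (D rest) _ })
      λ C i k → id , id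
      where
      >-wf : ∀ k → Acc (flip (Ordinal._<_ (fin {ℓ} m))) k
      >-wf k = accessible (Fin.>-wellFounded (lower k))
        where
        accessible : ∀ {k} → Acc (flip _<ᶠ_) (lower k) → Acc (flip (Ordinal._<_ (fin {ℓ} m))) k
        accessible (acc rs) = acc λ (lift p) → accessible (rs p)

      full : ((A , _) : Σ _ (IsCopy (fin {ℓ} m))) → ∀ x → A x
      full = noetherian⇒fullCopies (fin m) >-wf

      uncurried : (∀ i → Fin (s i) → Σ _ (IsCopy (ω^ (δ i)))) → ∀ i → Σ _ (IsCopy (T i))
      uncurried C (block i k) = C i k
      uncurried C rest        = fullCopy (fin m)

mainTheorem2 : ∀ {ℓ} (n : ℕ) → 1 ≤ n →
    (δ : Fin n → Ordinal ℓ) (s : Fin n → ℕ) (m : ℕ) →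
    (∀ i → fin 0 <ₒ δ i) →
    (∀ i j → i <ᶠ j → δ i <ₒ δ j) →
    (∀ i → 1 ≤ s i) →
    (α : Ordinal ℓ) → α ≃ₒ cantorSum n δ s +ₒ fin m →
    (preorder (ℙ α) ≅ ∏ (Fin n) (λ i → preorder (ℙ (ω^ (δ i))) ^ s i))
    × (sm (preorder (ℙ α)) ≅ ∏ (Fin n) (λ i → sm (preorder (ℙ (ω^ (δ i)))) ^ s i))
    × (preorder (sq (preorder (ℙ α))) ≅ ∏ (Fin n) (λ i → preorder (sq (preorder (ℙ (ω^ (δ i))))) ^ s i))
mainTheorem2 n _ δ s m δ>0 δ-inc _ α α≃ =
  iso ,
  -- The product is nested, over `Fin n` and then over each `Fin (s i)`, so `sm` is moved inside
  -- twice; `sq` is treated the same way.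
  ≅-trans (sm P) (sm (∏ (Fin n) Q^)) (∏ (Fin n) smQ^) (sm-cong P (∏ (Fin n) Q^) iso)
    (≅-trans (sm (∏ (Fin n) Q^)) (∏ (Fin n) (sm ∘ Q^)) (∏ (Fin n) smQ^) (sm-∏ Fin._≟_ Q^)
      (∏-cong (Fin n) (sm ∘ Q^) smQ^ λ i → sm-∏ Fin._≟_ λ _ → Q i)) ,
  ≅-trans (sq-preorder P) (sq-preorder (∏ (Fin n) Q^)) (∏ (Fin n) sqQ^)
    (sq-cong P (∏ (Fin n) Q^) iso)
    (≅-trans (sq-preorder (∏ (Fin n) Q^)) (∏ (Fin n) (sq-preorder ∘ Q^)) (∏ (Fin n) sqQ^)
      (sq-∏ Fin._≟_ Q^)
      (∏-cong (Fin n) (sq-preorder ∘ Q^) sqQ^ λ i → sq-∏ Fin._≟_ λ _ → Q i))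
  where
  P = preorder (ℙ α)

  Q = λ i → preorder (ℙ (ω^ (δ i)))

  Q^ = λ i → Q i ^ s i

  smQ^ = λ i → sm (Q i) ^ s i

  sqQ^ = λ i → sq-preorder (Q i) ^ s i

  iso : P ≅ ∏ (Fin n) Q^
  iso = ≅-trans P (∏ (Index s) (preorder ∘ ℙ ∘ term s δ m)) (∏ (Fin n) Q^)
    (ℙ-blocks (≺-cmp s) (≻-wf s) α (term s δ m)
      (Blocks-resp-≃ₒ α (cantorSum n δ s +ₒ fin m) α≃ (cantorBlocks n δ s m))
      (term-absorb δ s m δ>0 δ-inc))
    (ℙ-curry δ s m)
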